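{- For every $k\ge 5$ there exists an edge-ordered graph $G_k$ whose underlying graph is the complete graph $K_k$ such that \[sat_e(n,e_0+G_k+e_{\max})=\Omega(n\sqrt{\log n}).\]
   Context: An edge-ordered graph is a finite simple graph together with a linear order on its edge set (usually given by an injective labeling $l:E\to\mathbb{N}$ or $l:E\to\mathbb{R}$). An edge-ordered graph $H$ contains $F$ (has a copy of $F$) if $F$ is isomorphic, by an isomorphism respecting the edge-order, to a subgraph of $H$ with the induced order; otherwise $H$ is $F$-free. For an edge-ordered graph $G$, $e_0+G+e_{\max}$ denotes the edge-ordered graph obtained from $G$ by adding two edges $e_0$ and $e_{\max}$, vertex-disjoint from $G$ and from each other, where $e_0$ has a label smaller than, and $e_{\max}$ a label larger than, all other labels. $sat_e(n,F)$ is the minimum number of edges in an $F$-free edge-ordered graph $H$ on $n$ vertices such that adding to $H$ any missing edge, inserted at an arbitrary position of the linear order of the edges, creates a copy of $F$ (i.e. for every missing edge and every position, a copy is created). Asymptotic notation is for $n\to\infty$ with $k$ and $G_k$ fixed. -}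

module Defs where

open import Data.Fin.Base as Fin using (Fin; zero; suc; _↑ʳ_; combine; finToFun; funToFin)
open import Data.Fin.Patterns using (0F; 1F; 2F; 3F)
import Data.Fin.Properties as Fin
open import Data.List.Base using (List; []; _∷_; _++_; [_]; map; length; insertAt; lookup)
open import Data.List.Membership.Propositional using (_∈_; _∉_)
open import Data.List.Membership.Propositional.Properties using (∈-lookup)
open import Data.List.Relation.Binary.Sublist.Heterogeneous using (Sublist; []; _∷_; _∷ʳ_)
open import Data.List.Relation.Binary.Sublist.Heterogeneous.Properties using (sublist?)
open import Data.List.Relation.Unary.All as All using (All; []; _∷_)
open import Data.List.Relation.Unary.AllPairs using ([]; _∷_; allPairs?)
open import Data.List.Relation.Unary.Any as Any using (here; there)
open import Data.List.Relation.Unary.Unique.Propositional using (Unique)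
import Data.List.Relation.Unary.Unique.Propositional.Properties as Unique
open import Data.Nat.Base using (ℕ; zero; suc; _+_; _*_; _^_; _≤_; _<_; s<s; z<s; NonZero)
open import Data.Nat.Induction using (<-wellFounded)
open import Data.Nat.Logarithm using (⌈log₂_⌉)
open import Data.Nat.Properties as ℕ using (≤-refl)
open import Data.Product.Base using (∃; ∃-syntax; Σ-syntax; _×_; _,_; proj₁; proj₂)
open import Data.Sum.Base using (_⊎_; inj₁; inj₂)
open import Function.Base using (_∘_)
open import Function.Definitions using (Injective)
open import Induction.WellFounded using (Acc; acc)
open import Relation.Binary.Definitions using (DecidableEquality)
open import Relation.Binary.PropositionalEquality
  using (_≡_; _≗_; refl; sym; trans; cong; subst)
open import Relation.Nullary using (¬_; Dec; yes; no; contradiction)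
open import Relation.Nullary.Decidable using (map′; recompute; _×-dec_; _⊎-dec_; _→-dec_; ¬?; decidable-stable)
open import Relation.Unary using (Decidable)

private
  variable
    k m n : ℕ

------------------------------------------------------------------------
-- Edge-ordered graphs

-- An unordered pair of distinct vertices, stored smaller endpoint first.
-- Irrelevance of the proof makes equality of edges equality of endpoints.

record Edge (n : ℕ) : Set where
  constructor edge
  field
    src tgt  : Fin n
    .src<tgt : src Fin.< tgt

open Edge public

-- A finite simple graph with vertex set Fin n whose edge set is linearly
-- ordered: its edges are listed without repetition in increasing order.

record EdgeOrderedGraph (n : ℕ) : Set where
  constructor graph
  field
    edges  : List (Edge n)
    unique : Unique edges

  size : ℕ
  size = length edges

open EdgeOrderedGraph public

Complete : EdgeOrderedGraph n → Set
Complete G = ∀ e → e ∈ edges G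

-- The edge e′ is the image under φ of the edge e.

Maps : (Fin m → Fin n) → Edge m → Edge n → Set
Maps φ e e′ =
  (φ (src e) ≡ src e′ × φ (tgt e) ≡ tgt e′) ⊎
  (φ (src e) ≡ tgt e′ × φ (tgt e) ≡ src e′)

-- An injective map of vertices sending the edges of F, in their order, to
-- a subsequence of the edges of H; that is, an order-respecting
-- isomorphism from F onto a (not necessarily induced) subgraph of H.

Contains : EdgeOrderedGraph n → EdgeOrderedGraph m → Set
Contains {n} {m} H F =
  Σ[ φ ∈ (Fin m → Fin n) ]
    Injective _≡_ _≡_ φ × Sublist (Maps φ) (edges F) (edges H)

_IsFree_ : EdgeOrderedGraph n → EdgeOrderedGraph m → Set
H IsFree F = ¬ Contains H F

------------------------------------------------------------------------
-- Adding an edge at an arbitrary position of the edge order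

All-insertAt : {A : Set} {P : A → Set} {xs : List A} {x : A} (i : Fin (suc (length xs))) →
               P x → All P xs → All P (insertAt xs i x)
All-insertAt zero    p ps       = p ∷ ps
All-insertAt (suc i) p (q ∷ ps) = q ∷ All-insertAt i p ps

Unique-insertAt : {A : Set} {xs : List A} {x : A} (i : Fin (suc (length xs))) →
                  x ∉ xs → Unique xs → Unique (insertAt xs i x)
Unique-insertAt zero x∉ u = All.tabulate (λ { y∈ refl → x∉ y∈ }) ∷ u
Unique-insertAt (suc i) x∉ (y≢ ∷ u) =
  All-insertAt i (λ y≡x → x∉ (here (sym y≡x))) y≢ ∷ Unique-insertAt i (x∉ ∘ there) u

insertEdge : (H : EdgeOrderedGraph n) (e : Edge n) → e ∉ edges H →
             Fin (suc (size H)) → EdgeOrderedGraph n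
insertEdge H e e∉H i =
  graph (insertAt (edges H) i e) (Unique-insertAt i e∉H (unique H))

------------------------------------------------------------------------
-- The graph e₀ + G + eₘₐₓ

shift : Edge n → Edge (4 + n)
shift (edge u v u<v) = edge (4 ↑ʳ u) (4 ↑ʳ v) (s<s (s<s (s<s (s<s u<v))))

shift-injective : {e f : Edge n} → shift e ≡ shift f → e ≡ f
shift-injective refl = refl

e₀ eₘₐₓ : Edge (4 + n)
e₀   = edge 0F 1F z<s
eₘₐₓ = edge 2F 3F (s<s (s<s z<s))

e₀∉ : (es : List (Edge n)) → e₀ ∉ map shift es ++ [ eₘₐₓ ]
e₀∉ []       (here ())
e₀∉ (e ∷ es) (here ())
e₀∉ (e ∷ es) (there p) = e₀∉ es p

eₘₐₓ∉ : (es : List (Edge n)) → eₘₐₓ ∉ map shift es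
eₘₐₓ∉ (e ∷ es) (here ())
eₘₐₓ∉ (e ∷ es) (there p) = eₘₐₓ∉ es p

-- The four new vertices come first: e₀ joins 0 and 1, eₘₐₓ joins 2 and 3.

e₀+_+eₘₐₓ : EdgeOrderedGraph n → EdgeOrderedGraph (4 + n)
e₀+ G +eₘₐₓ = graph
  (e₀ ∷ map shift (edges G) ++ [ eₘₐₓ ])
  (All.tabulate (λ { p refl → e₀∉ (edges G) p })
    ∷ Unique.++⁺ (Unique.map⁺ shift-injective (unique G)) ([] ∷ [])
        (λ { (p , here refl) → eₘₐₓ∉ (edges G) p }))

------------------------------------------------------------------------
-- Saturation

Saturated : EdgeOrderedGraph n → EdgeOrderedGraph m → Set
Saturated H F =
  H IsFree F ×
  (∀ e (e∉H : e ∉ edges H) i → Contains (insertEdge H e e∉H i) F)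

record IsSatₑ (n : ℕ) (F : EdgeOrderedGraph m) (s : ℕ) : Set where
  field
    attained : Σ[ H ∈ EdgeOrderedGraph n ] Saturated H F × size H ≡ s
    minimal  : (H : EdgeOrderedGraph n) → Saturated H F → s ≤ size H

-- A saturated graph exists as soon as F has an edge: starting from the
-- edgeless graph, keep adding edges as long as no copy of F appears.
-- Saturation being decidable, the minimum can then be found by search.

_≟ₑ_ : DecidableEquality (Edge n)
edge u v _ ≟ₑ edge u′ v′ _ =
  map′ (λ { (refl , refl) → refl }) (λ { refl → refl , refl })
       (u Fin.≟ u′ ×-dec v Fin.≟ v′)

_∉?_ : (e : Edge n) (es : List (Edge n)) → Dec (e ∉ es)
e ∉? es = ¬? (Any.any? (e ≟ₑ_) es)

anyEdge? : {P : Edge n → Set} → Decidable P → Dec (∃ P)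
anyEdge? {P = P} P? =
  map′ (λ (u , v , u<v , p) → edge u v u<v , p)
       (λ (edge u v u<v , p) → u , v , recompute (u Fin.<? v) u<v , p)
       (Fin.any? λ u → Fin.any? λ v → inner u v)
  where
  inner : ∀ u v → Dec (Σ[ u<v ∈ u Fin.< v ] P (edge u v u<v))
  inner u v with u Fin.<? v
  ... | no u≮v  = no (u≮v ∘ proj₁)
  ... | yes u<v = map′ (u<v ,_) proj₂ (P? (edge u v u<v))

anyList? : (s : ℕ) {P : List (Edge n) → Set} → Decidable P →
           Dec (∃[ es ] length es ≡ s × P es)
anyList? zero P? =
  map′ (λ p → [] , refl , p) (λ { ([] , _ , p) → p }) (P? [])
anyList? (suc s) P? =
  map′ (λ (e , es , eq , p) → e ∷ es , cong suc eq , p)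
       (λ { (e ∷ es , eq , p) → e , es , ℕ.suc-injective eq , p })
       (anyEdge? λ e → anyList? s (P? ∘ (e ∷_)))

Copy : EdgeOrderedGraph n → EdgeOrderedGraph m → (Fin m → Fin n) → Set
Copy H F φ = Injective _≡_ _≡_ φ × Sublist (Maps φ) (edges F) (edges H)

copy? : (H : EdgeOrderedGraph n) (F : EdgeOrderedGraph m) (φ : Fin m → Fin n) →
        Dec (Copy H F φ)
copy? H F φ = injective? ×-dec sublist? maps? (edges F) (edges H)
  where
  injective? : Dec (Injective _≡_ _≡_ φ)
  injective? =
    map′ (λ inj {i} {j} → inj i j) (λ inj i j → inj)
         (Fin.all? λ i → Fin.all? λ j → (φ i Fin.≟ φ j) →-dec (i Fin.≟ j))
  maps? : ∀ e e′ → Dec (Maps φ e e′)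
  maps? e e′ =
    (φ (src e) Fin.≟ src e′ ×-dec φ (tgt e) Fin.≟ tgt e′) ⊎-dec
    (φ (src e) Fin.≟ tgt e′ ×-dec φ (tgt e) Fin.≟ src e′)

copy-resp : (H : EdgeOrderedGraph n) (F : EdgeOrderedGraph m) {φ ψ : Fin m → Fin n} →
            ψ ≗ φ → Copy H F φ → Copy H F ψ
copy-resp H F {φ} {ψ} eq (inj , sub) =
  (λ {x} {y} p → inj (trans (sym (eq x)) (trans p (eq y)))) , go sub
  where
  maps : ∀ {e e′} → Maps φ e e′ → Maps ψ e e′
  maps (inj₁ (p , q)) = inj₁ (trans (eq _) p , trans (eq _) q)
  maps (inj₂ (p , q)) = inj₂ (trans (eq _) p , trans (eq _) q)
  go : ∀ {es es′} → Sublist (Maps φ) es es′ → Sublist (Maps ψ) es es′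
  go []       = []
  go (e ∷ʳ s) = e ∷ʳ go s
  go (_∷_ {x = e} {y = e′} r s) = maps {e} {e′} r ∷ go s

contains? : (H : EdgeOrderedGraph n) (F : EdgeOrderedGraph m) → Dec (Contains H F)
contains? H F =
  map′ (λ (i , c) → finToFun i , c)
       (λ (φ , c) → funToFin φ , copy-resp H F (Fin.finToFun-funToFin φ) c)
       (Fin.any? (copy? H F ∘ finToFun))

Extendable : EdgeOrderedGraph n → EdgeOrderedGraph m → Set
Extendable H F =
  ∃[ e ] Σ[ e∉H ∈ e ∉ edges H ] ∃[ i ] insertEdge H e e∉H i IsFree F

extendable? : (H : EdgeOrderedGraph n) (F : EdgeOrderedGraph m) → Dec (Extendable H F)
extendable? H F = anyEdge? inner
  where
  inner : ∀ e → Dec (Σ[ e∉H ∈ e ∉ edges H ] ∃[ i ] insertEdge H e e∉H i IsFree F)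
  inner e with e ∉? edges H
  ... | no  e∈H = no (e∈H ∘ proj₁)
  ... | yes e∉H = map′ (e∉H ,_) proj₂ (Fin.any? λ i → ¬? (contains? (insertEdge H e e∉H i) F))

¬extendable⇒saturated : (H : EdgeOrderedGraph n) (F : EdgeOrderedGraph m) →
                        H IsFree F → ¬ Extendable H F → Saturated H F
¬extendable⇒saturated H F free ¬ext = free , λ e e∉H i →
  decidable-stable (contains? (insertEdge H e e∉H i) F) (λ ¬c → ¬ext (e , e∉H , i , ¬c))

saturated? : (H : EdgeOrderedGraph n) (F : EdgeOrderedGraph m) → Dec (Saturated H F)
saturated? H F with contains? H F | extendable? H F
... | yes c   | _       = no λ (free , _) → free c
... | no free | yes (e , e∉H , i , ¬c) = no λ (_ , sat) → ¬c (sat e e∉H i)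
... | no free | no ¬ext = yes (¬extendable⇒saturated H F free ¬ext)

SaturatedOfSize : (n : ℕ) → EdgeOrderedGraph m → ℕ → Set
SaturatedOfSize n F s = Σ[ H ∈ EdgeOrderedGraph n ] Saturated H F × size H ≡ s

saturatedOfSize? : ∀ n (F : EdgeOrderedGraph m) → Decidable (SaturatedOfSize n F)
saturatedOfSize? n F s =
  map′ (λ (es , eq , u , sat) → graph es u , sat , eq)
       (λ (graph es u , sat , eq) → es , eq , u , sat)
       (anyList? s λ es → inner es)
  where
  inner : ∀ es → Dec (Σ[ u ∈ Unique es ] Saturated (graph es u) F)
  inner es with allPairs? (λ e f → ¬? (e ≟ₑ f)) es
  ... | no ¬u = no (¬u ∘ proj₁)
  ... | yes u = map′ (u ,_) proj₂ (saturated? (graph es u) F)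

lookup-injective : {A : Set} {xs : List A} → Unique xs → Injective _≡_ _≡_ (lookup xs)
lookup-injective (_ ∷ _) {zero} {zero} _ = refl
lookup-injective (x≢ ∷ _) {zero} {suc j} eq =
  contradiction eq (All.lookup x≢ (∈-lookup j))
lookup-injective (x≢ ∷ _) {suc i} {zero} eq =
  contradiction (sym eq) (All.lookup x≢ (∈-lookup i))
lookup-injective (_ ∷ u) {suc i} {suc j} eq = cong suc (lookup-injective u eq)

size≤n*n : (H : EdgeOrderedGraph n) → size H ≤ n * n
size≤n*n H = Fin.injective⇒≤ (lookup-injective (unique H) ∘ code-injective)
  where
  code-injective : Injective _≡_ _≡_ (λ (e : Edge _) → combine (src e) (tgt e))
  code-injective {edge u v _} {edge u′ v′ _} eq
    with refl , refl ← Fin.combine-injective u v u′ v′ eq = refl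

length-insertAt : {A : Set} (xs : List A) (i : Fin (suc (length xs))) {x : A} →
                  length (insertAt xs i x) ≡ suc (length xs)
length-insertAt xs       zero    = refl
length-insertAt (_ ∷ xs) (suc i) = cong suc (length-insertAt xs i)

saturate : (F : EdgeOrderedGraph m) (fuel : ℕ) (H : EdgeOrderedGraph n) →
           n * n < size H + fuel → H IsFree F → Σ[ H ∈ EdgeOrderedGraph n ] Saturated H F
saturate {n = n} F zero H bound _ =
  contradiction (size≤n*n H) (ℕ.<⇒≱ (subst (n * n <_) (ℕ.+-identityʳ _) bound))
saturate {n = n} F (suc fuel) H bound free with extendable? H F
... | no ¬ext = H , ¬extendable⇒saturated H F free ¬ext
... | yes (e , e∉H , i , free′) =
  saturate F fuel (insertEdge H e e∉H i) (subst (n * n <_) eq bound) free′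
  where
  eq : size H + suc fuel ≡ length (insertAt (edges H) i e) + fuel
  eq = trans (ℕ.+-suc _ fuel) (cong (_+ fuel) (sym (length-insertAt (edges H) i)))

saturated-exists : ∀ n (F : EdgeOrderedGraph m) .{{_ : NonZero (size F)}} →
                   Σ[ H ∈ EdgeOrderedGraph n ] Saturated H F
saturated-exists n F@(graph (_ ∷ _) _) =
  saturate F (suc (n * n)) (graph [] []) ≤-refl (λ { (_ , _ , ()) })

least : {P : ℕ → Set} → Decidable P → ∀ {s} → P s →
        ∃[ t ] P t × (∀ {j} → P j → t ≤ j)
least {P} P? {s} p = go s (<-wellFounded s) p
  where
  go : ∀ s → Acc _<_ s → P s → ∃[ t ] P t × (∀ {j} → P j → t ≤ j)
  go s (acc rec) p with ℕ.anyUpTo? P? s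
  ... | yes (j , j<s , q) = go j (rec j<s) q
  ... | no none = s , p , λ {j} q → ℕ.≮⇒≥ (λ j<s → none (j , j<s , q))

abstract
  satₑ-exists : ∀ n (F : EdgeOrderedGraph m) .{{_ : NonZero (size F)}} →
                ∃[ s ] IsSatₑ n F s
  satₑ-exists n F with saturated-exists n F
  ... | H , sat with least (saturatedOfSize? n F) (H , sat , refl)
  ...   | s , att , min = s , record
    { attained = att
    ; minimal  = λ H′ sat′ → min (H′ , sat′ , refl)
    }

satₑ : (n : ℕ) (F : EdgeOrderedGraph m) .{{_ : NonZero (size F)}} → ℕ
satₑ n F = proj₁ (satₑ-exists n F)

satₑ-isSatₑ : ∀ n (F : EdgeOrderedGraph m) .{{_ : NonZero (size F)}} → IsSatₑ n F (satₑ n F)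
satₑ-isSatₑ n F = proj₂ (satₑ-exists n F)

------------------------------------------------------------------------
-- Asymptotics

-- f(n) ≥ c n √(log n) for some real c > 0 and all large n. With c = 1/C and
-- both sides squared this is n² log n ≤ (C f(n))²; the base of the logarithm
-- and its rounding only affect the constant C.

_∈Ω[n√log-n] : (ℕ → ℕ) → Set
f ∈Ω[n√log-n] =
  ∃[ C ] ∃[ N ] ∀ n → N ≤ n → n ^ 2 * ⌈log₂ n ⌉ ≤ (C * f n) ^ 2

{-# OPTIONS --safe #-}

-- Order the edges of K_k so that any two vertices u and v cross: they have
-- common neighbours w and w′ with uw before uw′ but vw′ before vw. If a missing
-- edge uv of H completes a copy of G, then u and v cross in H, so in their lists
-- of neighbours, ordered by the edge order, some vertex has different ranks. In
-- a random colouring of the vertices of H by q colours, the events "the i-th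
-- neighbour of u has colour i for all i" are therefore disjoint for different u,
-- and at most q ^ q vertices have fewer than q neighbours. For q ≈ √ log n this
-- leaves half of the vertices with degree at least q.
--
-- It remains to find a position at which the missing edge plays neither e₀ nor
-- eₘₐₓ. Slide it through the edge order. If it plays e₀ at one position and
-- eₘₐₓ at the next, then H contains an early copy of e₀ + G and a late copy of
-- G + eₘₐₓ that share at most one edge. As H is free, every edge of the late G
-- meets the early e₀ + G, which is impossible for k ≥ 5.

module Submission where

open import Defs
open import Data.Bool.Base using (if_then_else_; true; false)
open import Data.Empty using (⊥)
open import Data.Fin.Base as Fin using (Fin; zero; suc; _↑ʳ_)
open import Data.Fin.Patterns using (0F; 1F; 2F; 3F)
import Data.Fin.Properties as Fin
open import Data.List.Base using (List; []; _∷_; _++_; [_]; map; length; filter; allFin; concatMap;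
  insertAt; tabulate; reverse)
open import Data.List.Membership.Propositional using (_∈_; _∉_; find)
open import Data.List.Membership.Propositional.Properties
  using (∈-allFin; ∈-++⁺ˡ; ∈-++⁺ʳ; ∈-map⁻; ∈-concatMap⁻; ∈-tabulate⁻)
open import Data.List.Properties using (length-tabulate; ++-assoc; ++-identityʳ; ∷-injective)
import Data.List.Relation.Binary.Permutation.Setoid as Permutation
import Data.List.Relation.Binary.Permutation.Setoid.Properties as PermutationProperties
open import Data.List.Relation.Binary.Sublist.Heterogeneous as Sublist
  using (Sublist; []; _∷_; _∷ʳ_)
import Data.List.Relation.Binary.Sublist.Heterogeneous.Properties as Sublist
open import Data.List.Relation.Binary.Sublist.Propositional as Sub using (_⊆_)
open import Data.List.Relation.Unary.All as All using (All; []; _∷_)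
import Data.List.Relation.Unary.All.Properties as All
open import Data.List.Relation.Unary.AllPairs as AllPairs using (AllPairs; []; _∷_)
import Data.List.Relation.Unary.AllPairs.Properties as AllPairs
open import Data.List.Relation.Unary.Any as Any using (Any; here; there)
import Data.List.Relation.Unary.Any.Properties as Any
open import Data.List.Relation.Unary.Unique.Propositional using (Unique)
import Data.List.Relation.Unary.Unique.Propositional.Properties as Unique
open import Data.Maybe.Base as Maybe using (just; Maybe; nothing; maybe′)
open import Data.Maybe.Relation.Unary.All as MAll using (just; nothing)
open import Data.Nat.Base
open import Data.Nat.ListAction using (sum)
open import Data.Nat.Logarithm using (⌈log₂_⌉; ⌈log₂⌉-mono-≤; ⌈log₂2^n⌉≡n)
open import Data.Nat.Properties hiding (_≟_)
open import Data.Nat.Tactic.RingSolver using (solve-∀)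
open import Data.Product.Base using (∃; ∃₂; Σ-syntax; _×_; _,_; proj₁; proj₂)
open import Data.Sum.Base as Sum using (_⊎_; inj₁; inj₂)
open import Function.Base using (_∘_; id)
open import Function.Definitions using (Injective)
open import Relation.Binary.Definitions using (tri<; tri≈; tri>)
open import Relation.Binary.PropositionalEquality hiding ([_])
open import Relation.Nullary using (¬_; Dec; yes; no; does; contradiction)
open import Relation.Nullary.Decidable using (from-yes; ¬?; _→-dec_; recompute; _×-dec_; _⊎-dec_)
open import Relation.Unary using (Decidable)

private
  variable
    A X : Set
    k m n q : ℕ
    es : List (Edge n)

-- Sums over lists.

sum-map-+ : (f g : X → ℕ) (xs : List X) →
            sum (map (λ x → f x + g x) xs) ≡ sum (map f xs) + sum (map g xs)
sum-map-+ f g []       = refl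
sum-map-+ f g (x ∷ xs) = begin
  f x + g x + sum (map (λ x → f x + g x) xs)   ≡⟨ cong (f x + g x +_) (sum-map-+ f g xs) ⟩
  f x + g x + (sum (map f xs) + sum (map g xs)) ≡⟨ shuffle (f x) (g x) _ _ ⟩
  f x + sum (map f xs) + (g x + sum (map g xs)) ∎
  where
  open ≡-Reasoning
  shuffle : ∀ a b c d → a + b + (c + d) ≡ a + c + (b + d)
  shuffle = solve-∀

sum-map-mono : {f g : X → ℕ} {xs : List X} → All (λ x → f x ≤ g x) xs →
               sum (map f xs) ≤ sum (map g xs)
sum-map-mono []       = z≤n
sum-map-mono (p ∷ ps) = +-mono-≤ p (sum-map-mono ps)

sum-map-const : (b : ℕ) (xs : List X) → sum (map (λ _ → b) xs) ≡ length xs * b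
sum-map-const b []       = refl
sum-map-const b (_ ∷ xs) = cong (b +_) (sum-map-const b xs)

∈⇒≤sum-map : (f : X → ℕ) {xs : List X} {x : X} → x ∈ xs → f x ≤ sum (map f xs)
∈⇒≤sum-map f {y ∷ _} (here refl) = m≤m+n _ _
∈⇒≤sum-map f {y ∷ _} (there x∈)  = ≤-trans (∈⇒≤sum-map f x∈) (m≤n+m _ (f y))

-- Uniqueness of `xs` means that `y` is met at most once, so its excess of one is paid at most once.
-- This serves both the gaps of a ranking and the handshake count.
sum-map-bump : {f g : Fin n → ℕ} (y : Fin n) → f y ≤ suc (g y) →
               (∀ {x} → y ≢ x → f x ≤ g x) →
               {xs : List (Fin n)} → Unique xs → sum (map f xs) ≤ suc (sum (map g xs))
sum-map-bump y at off [] = z≤n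
sum-map-bump {f = f} {g} y at off {x ∷ xs} (x∉ ∷ u) with y Fin.≟ x
... | yes refl = +-mono-≤ at (sum-map-mono (All.map off x∉))
... | no y≢x   = begin
  f x + sum (map f xs)       ≤⟨ +-mono-≤ (off y≢x) (sum-map-bump y at off u) ⟩
  g x + suc (sum (map g xs)) ≡⟨ +-suc (g x) _ ⟩
  suc (g x + sum (map g xs)) ∎
  where open ≤-Reasoning

sum-map-filter : {P : A → Set} (P? : Decidable P) (f : A → ℕ) (a : A) (as : List A) →
                 sum (map f (filter P? (a ∷ as))) ≡
                 (if does (P? a) then f a else 0) + sum (map f (filter P? as))
sum-map-filter P? f a as with does (P? a)
... | true  = refl
... | false = refl

allPairs-refine : {P : A → Set} {R T : A → A → Set} → (∀ {a b} → P a → P b → R a b → T a b) →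
                  {as : List A} → All P as → AllPairs R as → AllPairs T as
allPairs-refine f []       []       = []
allPairs-refine f (p ∷ ps) (r ∷ rs) =
  All.zipWith (λ (q , r) → f p q r) (ps , r) ∷ allPairs-refine f ps rs

-- Partial colourings and a Kraft inequality.

Clash : Maybe A → Maybe A → Set
Clash m m′ = ∃₂ λ a b → m ≡ just a × m′ ≡ just b × a ≢ b

-- An undefined value accepts every colour, so a partial colouring constrains only where it is
-- defined.
Fits : A → Maybe A → Set
Fits c = MAll.All (c ≡_)

fits? : (c : Fin q) → Decidable (Fits c)
fits? c = MAll.dec (c Fin.≟_)

¬clash : {c : A} {m m′ : Maybe A} → Fits c m → Fits c m′ → ¬ Clash m m′
¬clash (just refl) (just refl) (_ , _ , refl , refl , a≢b) = a≢b refl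

gap : Maybe A → ℕ
gap = maybe′ (λ _ → 0) 1

gaps : (X → Maybe A) → List X → ℕ
gaps m xs = sum (map (gap ∘ m) xs)

-- At a gap all `q` colours contribute and equality holds; at `just a` the summand for `a` alone
-- suffices.
weight-split : (m : Maybe (Fin q)) (g : ℕ) →
               q ^ (gap m + g) ≤ sum (map (λ c → if does (fits? c m) then q ^ g else 0) (allFin q))
weight-split {q} nothing g = ≤-reflexive (sym (begin
  sum (map (λ _ → q ^ g) (allFin q)) ≡⟨ sum-map-const (q ^ g) (allFin q) ⟩
  length (allFin q) * q ^ g          ≡⟨ cong (_* q ^ g) (length-tabulate {n = q} id) ⟩
  q * q ^ g                          ∎))
  where open ≡-Reasoning
weight-split {q} (just a) g = ≤-trans at-a (∈⇒≤sum-map f (∈-allFin a))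
  where
  f : Fin q → ℕ
  f c = if does (fits? c (just a)) then q ^ g else 0
  at-a : q ^ g ≤ f a
  at-a with a Fin.≟ a
  ... | yes _  = ≤-refl
  ... | no a≢a = contradiction refl a≢a

-- Colour X at random with q colours: q ^ gaps of the q ^ length xs colourings
-- of xs agree with a given partial colouring, and none agrees with two
-- clashing ones.
kraft : (p : A → X → Maybe (Fin q)) (xs : List X) (as : List A) →
        AllPairs (λ a b → Any (λ x → Clash (p a x) (p b x)) xs) as →
        sum (map (λ a → q ^ gaps (p a) xs) as) ≤ q ^ length xs
kraft p []       []          _               = z≤n
kraft p []       (_ ∷ [])    _               = ≤-refl
-- With no coordinate left there is nowhere to clash, so at most one partial colouring survives, of
-- weight one.
kraft p []       (_ ∷ _ ∷ _) ((() ∷ _) ∷ _)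
kraft {A} {X} {q} p (x ∷ xs) as          clash            = begin
  sum (map (λ a → q ^ (gap (p a x) + gaps (p a) xs)) as)  ≤⟨ split as ⟩
  sum (map (λ c → sum (map w (as∣ c))) (allFin q))
    ≤⟨ sum-map-mono (All.universal each (allFin q)) ⟩
  sum (map (λ _ → q ^ length xs) (allFin q))               ≡⟨ sum-map-const _ (allFin q) ⟩
  length (allFin q) * q ^ length xs
    ≡⟨ cong (_* q ^ length xs) (length-tabulate {n = q} id) ⟩
  q * q ^ length xs                                        ∎
  where
  open ≤-Reasoning
  w : A → ℕ
  w a = q ^ gaps (p a) xs

  at-x? : (c : Fin q) → Decidable (λ a → Fits c (p a x))
  at-x? c a = fits? c (p a x)

  as∣ : Fin q → List A
  as∣ c = filter (at-x? c) as

  -- Condition on the colour `c` of `x`: partial colouring that fit `c` at `x` cannot clash there,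
  -- so they still clash within `xs`.
  each : ∀ c → sum (map w (as∣ c)) ≤ q ^ length xs
  each c = kraft p xs (as∣ c)
    (allPairs-refine later (All.all-filter (at-x? c) as) (AllPairs.filter⁺ (at-x? c) clash))
    where
    later : ∀ {a b} → Fits c (p a x) → Fits c (p b x) →
            Any (λ x → Clash (p a x) (p b x)) (x ∷ xs) → Any (λ x → Clash (p a x) (p b x)) xs
    later fa fb (here cl)  = contradiction cl (¬clash fa fb)
    later fa fb (there cl) = cl

  split : ∀ as → sum (map (λ a → q ^ (gap (p a x) + gaps (p a) xs)) as) ≤
                 sum (map (λ c → sum (map w (filter (at-x? c) as))) (allFin q))
  split []       = z≤n
  split (a ∷ as) = begin
    q ^ (gap (p a x) + gaps (p a) xs) + sum (map (λ a → q ^ (gap (p a x) + gaps (p a) xs)) as)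
      ≤⟨ +-mono-≤ (weight-split (p a x) (gaps (p a) xs)) (split as) ⟩
    sum (map (λ c → if does (at-x? c a) then w a else 0) (allFin q)) +
    sum (map (λ c → sum (map w (filter (at-x? c) as))) (allFin q))
      ≡⟨ sum-map-+ _ _ (allFin q) ⟨
    sum (map (λ c → (if does (at-x? c a) then w a else 0) +
                    sum (map w (filter (at-x? c) as))) (allFin q))
      ≤⟨ sum-map-mono (All.universal
           (λ c → ≤-reflexive (sym (sum-map-filter (at-x? c) w a as))) (allFin q)) ⟩
    sum (map (λ c → sum (map w (filter (at-x? c) (a ∷ as)))) (allFin q)) ∎

-- Ranks in a list as a partial colouring.

-- Only the first q entries of the list are ranked.
rank : ∀ q → List (Fin n) → Fin n → Maybe (Fin q)
rank zero    _        x = nothing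
rank (suc q) []       x = nothing
rank (suc q) (y ∷ ys) x with y Fin.≟ x
... | yes _ = just zero
... | no  _ = Maybe.map suc (rank q ys x)

gap-nothing : {xs : List X} → sum (map {B = ℕ} (λ _ → gap {A = A} nothing) xs) ≡ length xs
gap-nothing {xs = xs} = trans (sum-map-const 1 xs) (*-identityʳ _)

-- Each entry of the list closes at most one gap: prepending `y` changes definedness of the rank at
-- most at `y`.
length≤gaps+length : ∀ q (l : List (Fin n)) {xs} → Unique xs →
                     length xs ≤ gaps (rank q l) xs + length l
length≤gaps+length zero    l        {xs} u =
  ≤-trans (≤-reflexive (sym (gap-nothing {A = Fin 0} {xs = xs}))) (m≤m+n _ _)
length≤gaps+length (suc q) []       {xs} u =
  ≤-trans (≤-reflexive (sym (gap-nothing {A = Fin 0} {xs = xs}))) (m≤m+n _ _)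
length≤gaps+length (suc q) (y ∷ ys) {xs} u = begin
  length xs                                                 ≤⟨ length≤gaps+length q ys u ⟩
  gaps (rank q ys) xs + length ys
    ≤⟨ +-monoˡ-≤ _ (sum-map-bump y (gap≤1 (rank q ys y)) off u) ⟩
  suc (gaps (rank (suc q) (y ∷ ys)) xs + length ys)         ≡⟨ +-suc _ _ ⟨
  gaps (rank (suc q) (y ∷ ys)) xs + suc (length ys)         ∎
  where
  open ≤-Reasoning
  gap≤1 : (m : Maybe (Fin q)) {k : ℕ} → gap m ≤ suc k
  gap≤1 (just _) = z≤n
  gap≤1 nothing  = s≤s z≤n
  gap-map : (m : Maybe (Fin q)) → gap m ≤ gap (Maybe.map Fin.suc m)
  gap-map (just _) = ≤-refl
  gap-map nothing  = ≤-refl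
  off : ∀ {x} → y ≢ x → gap (rank q ys x) ≤ gap (rank (suc q) (y ∷ ys) x)
  off {x} y≢x with y Fin.≟ x
  ... | yes y≡x = contradiction y≡x y≢x
  ... | no _    = gap-map (rank q ys x)

rank-head : ∀ q (l : List (Fin n)) x → rank (suc q) (x ∷ l) x ≡ just zero
rank-head q l x with x Fin.≟ x
... | yes _  = refl
... | no x≢x = contradiction refl x≢x

rank-∷-≢ : ∀ q {l : List (Fin n)} {x y : Fin n} {a} → y ≢ x → rank q l x ≡ just a →
         rank (suc q) (y ∷ l) x ≡ just (suc a)
rank-∷-≢ q {x = x} {y} y≢x eq with y Fin.≟ x
... | yes y≡x          = contradiction y≡x y≢x
... | no  _ rewrite eq = refl

∈⇒rank : ∀ {q} {l : List (Fin n)} {x} → length l ≤ q → x ∈ l → ∃ λ a → rank q l x ≡ just a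
∈⇒rank {x = x} (s≤s {n = q} len) (here {x = y} eq) with y Fin.≟ x
... | yes _  = zero , refl
... | no y≢x = contradiction (sym eq) y≢x
∈⇒rank {x = x} (s≤s {n = q} len) (there {x = y} x∈) with y Fin.≟ x | ∈⇒rank len x∈
... | yes _ | _      = zero , refl
... | no  _ | a , eq rewrite eq = suc a , refl

-- `rank` reports the first occurrence; uniqueness of `l` makes this the position used by the
-- sublist.
⊆⇒rank< : ∀ {q} {l : List (Fin n)} {x y} → Unique l → length l ≤ q → x ∷ y ∷ [] ⊆ l →
          ∃₂ λ a b → rank q l x ≡ just a × rank q l y ≡ just b × a Fin.< b
⊆⇒rank< {x = x} (z≢ ∷ u) (s≤s {n = q} len) (refl ∷ y∈) with ∈⇒rank len (Sub.to∈ y∈)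
... | b , eq =
  zero , suc b , rank-head q _ x , rank-∷-≢ q (All.lookup z≢ (Sub.to∈ y∈)) eq , z<s
⊆⇒rank< {x = x} {y} (z≢ ∷ u) (s≤s {n = q} len) (_ ∷ʳ xy⊆) with ⊆⇒rank< u len xy⊆
... | a , b , eqa , eqb , a<b =
  suc a , suc b ,
  rank-∷-≢ q (All.lookup z≢ (Sub.to∈ (Sub.⊆-trans (refl ∷ Sub.minimum _) xy⊆))) eqa ,
  rank-∷-≢ q (All.lookup z≢ (Sub.to∈ (Sub.⊆-trans (_ ∷ʳ refl ∷ []) xy⊆))) eqb , s<s a<b

-- If both `x` and `y` had the same rank in the two lists, their order would agree as well. So one
-- of them is a clash.
crossing⇒clash : ∀ {q} {l l′ : List (Fin n)} {x y} → Unique l → Unique l′ →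
                 length l ≤ q → length l′ ≤ q →
                 x ∷ y ∷ [] ⊆ l → y ∷ x ∷ [] ⊆ l′ →
                 ∃ λ z → Clash (rank q l z) (rank q l′ z)
crossing⇒clash {x = x} {y} u u′ len len′ xy yx
  with ⊆⇒rank< u len xy | ⊆⇒rank< u′ len′ yx
... | a , b , lx , ly , a<b | c , d , l′y , l′x , c<d with a Fin.≟ d
...   | no a≢d   = x , a , d , lx , l′x , a≢d
...   | yes refl = y , b , c , ly , l′y , λ { refl → Fin.<-asym {x = a} {y = b} a<b c<d }

-- At most `q` entries leave at least `n - q` vertices uncoloured, hence weight at least
-- `q ^ (n - q)`, while by `kraft` the weights add up to at most `q ^ n`. Multiplying by `q ^ q`
-- avoids the subtraction.
few-short-lists : (l : Fin n → List (Fin n)) (q : ℕ) .{{_ : NonZero q}} (us : List (Fin n)) →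
                  All (λ u → length (l u) ≤ q) us →
                  AllPairs (λ u v → ∃ λ z → Clash (rank q (l u) z) (rank q (l v) z)) us →
                  length us ≤ q ^ q
few-short-lists {n} l q us short clash = *-cancelʳ-≤ _ _ (q ^ n) {{m^n≢0 q n}} (begin
  length us * q ^ n                                   ≡⟨ sum-map-const (q ^ n) us ⟨
  sum (map (λ _ → q ^ n) us)                          ≤⟨ sum-map-mono (All.map bound short) ⟩
  sum (map (λ u → q ^ q * w u) us)                    ≡⟨ pull us ⟩
  q ^ q * sum (map w us)                              ≤⟨ *-monoʳ-≤ (q ^ q) weights ⟩
  q ^ q * q ^ n                                       ∎)
  where
  open ≤-Reasoning
  w : Fin n → ℕ
  w u = q ^ gaps (rank q (l u)) (allFin n)

  bound : ∀ {u} → length (l u) ≤ q → q ^ n ≤ q ^ q * w u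
  bound {u} len = begin
    q ^ n                                          ≤⟨ ^-monoʳ-≤ q (begin
      n                                              ≡⟨ length-tabulate {n = n} id ⟨
      length (allFin n)                              ≤⟨ length≤gaps+length q (l u) (Unique.allFin⁺ n) ⟩
      gaps (rank q (l u)) (allFin n) + length (l u)  ≤⟨ +-monoʳ-≤ _ len ⟩
      gaps (rank q (l u)) (allFin n) + q             ≡⟨ +-comm _ q ⟩
      q + gaps (rank q (l u)) (allFin n)             ∎) ⟩
    q ^ (q + gaps (rank q (l u)) (allFin n))       ≡⟨ ^-distribˡ-+-* q q _ ⟩
    q ^ q * w u                                    ∎

  pull : ∀ us → sum (map (λ u → q ^ q * w u) us) ≡ q ^ q * sum (map w us)
  pull []       = sym (*-zeroʳ (q ^ q))
  pull (u ∷ us) = trans (cong (q ^ q * w u +_) (pull us)) (sym (*-distribˡ-+ (q ^ q) (w u) _))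

  weights : sum (map w us) ≤ q ^ n
  weights = begin
    sum (map w us)        ≤⟨ kraft (λ u → rank q (l u)) (allFin n) us (AllPairs.map
                               (λ (z , cl) → Any.map (λ { refl → cl }) (∈-allFin z)) clash) ⟩
    q ^ length (allFin n) ≡⟨ cong (q ^_) (length-tabulate {n = n} id) ⟩
    q ^ n                 ∎

-- Edges, crossings and lists of neighbours.

Joins : Fin n → Fin n → Edge n → Set
Joins u v e = (u ≡ src e × v ≡ tgt e) ⊎ (u ≡ tgt e × v ≡ src e)

ordered : (e : Edge n) → src e Fin.< tgt e
ordered (edge u v u<v) = recompute (u Fin.<? v) u<v

src≢tgt : (e : Edge n) → src e ≢ tgt e
src≢tgt e = Fin.<⇒≢ (ordered e)

Joins-irrefl : {u : Fin n} (e : Edge n) → ¬ Joins u u e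
Joins-irrefl e (inj₁ (p , q)) = src≢tgt e (trans (sym p) q)
Joins-irrefl e (inj₂ (p , q)) = src≢tgt e (trans (sym q) p)

Joins-sym : {u v : Fin n} (e : Edge n) → Joins u v e → Joins v u e
Joins-sym e (inj₁ (p , q)) = inj₂ (q , p)
Joins-sym e (inj₂ (p , q)) = inj₁ (q , p)

Joins-det : {u v w : Fin n} (e : Edge n) → Joins u v e → Joins u w e → v ≡ w
Joins-det e (inj₁ (_ , q)) (inj₁ (_ , q′)) = trans q (sym q′)
Joins-det e (inj₂ (_ , q)) (inj₂ (_ , q′)) = trans q (sym q′)
Joins-det e (inj₁ (p , q)) (inj₂ (p′ , q′)) = contradiction (trans (sym p) p′) (src≢tgt e)
Joins-det e (inj₂ (p , q)) (inj₁ (p′ , q′)) = contradiction (trans (sym p′) p) (src≢tgt e)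

Joins-injective : {u v : Fin n} {e e′ : Edge n} → Joins u v e → Joins u v e′ → e ≡ e′
Joins-injective (inj₁ (refl , refl)) (inj₁ (refl , refl)) = refl
Joins-injective (inj₂ (refl , refl)) (inj₂ (refl , refl)) = refl
Joins-injective {e = e} {e′} (inj₁ (refl , refl)) (inj₂ (p , q)) =
  contradiction (ordered e′) (Fin.<-asym (subst₂ Fin._<_ p q (ordered e)))
Joins-injective {e = e} {e′} (inj₂ (refl , refl)) (inj₁ (p , q)) =
  contradiction (ordered e′) (Fin.<-asym (subst₂ Fin._<_ q p (ordered e)))

Joins-maps : {φ : Fin m → Fin n} {u v : Fin m} {e : Edge m} {e′ : Edge n} →
             Joins u v e → Maps φ e e′ → Joins (φ u) (φ v) e′
Joins-maps (inj₁ (refl , refl)) mp = mp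
Joins-maps {e′ = e′} (inj₂ (refl , refl)) mp = Joins-sym e′ mp

joins? : (u v : Fin n) → Decidable (Joins u v)
joins? u v e = (u Fin.≟ src e ×-dec v Fin.≟ tgt e) ⊎-dec (u Fin.≟ tgt e ×-dec v Fin.≟ src e)

joining : (u v : Fin n) → u ≢ v → ∃ λ e → Joins u v e
joining u v u≢v with Fin.<-cmp u v
... | tri< u<v _ _ = edge u v u<v , inj₁ (refl , refl)
... | tri≈ _ u≡v _ = contradiction u≡v u≢v
... | tri> _ _ v<u = edge v u v<u , inj₂ (refl , refl)

Adjacent : List (Edge n) → Fin n → Fin n → Set
Adjacent es u v = Any (Joins u v) es

adjacent-sym : {u v : Fin n} → Adjacent es u v → Adjacent es v u
adjacent-sym = Any.map (λ {e} → Joins-sym e)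

-- `Sublist (Joins u) ws es` encodes a row: edges from `u` to the members of `ws`, occurring in `es`
-- in this order.
Crossing : List (Edge n) → Fin n → Fin n → Set
Crossing es u v =
  ∃₂ λ w w′ → Sublist (Joins u) (w ∷ w′ ∷ []) es × Sublist (Joins v) (w′ ∷ w ∷ []) es

Crossing-sym : {u v : Fin n} → Crossing es u v → Crossing es v u
Crossing-sym (w , w′ , s , s′) = w′ , w , s′ , s

row-∌ : {v : Fin n} {ws : List (Fin n)} → Sublist (Joins v) ws es → v ∉ ws
row-∌ (_ ∷ʳ s)           v∈          = row-∌ s v∈
row-∌ (_∷_ {y = e} j s) (here refl) = Joins-irrefl e j
row-∌ (j ∷ s)           (there v∈)  = row-∌ s v∈

-- At most one part is nonempty, since the ends of an edge differ. Two independent conditionals let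
-- `handshake` strip the ends one at a time.
ends : Fin n → Edge n → List (Fin n)
ends u e = (if does (src e Fin.≟ u) then [ tgt e ] else []) ++
           (if does (tgt e Fin.≟ u) then [ src e ] else [])

neighbours : Fin n → List (Edge n) → List (Fin n)
neighbours u = concatMap (ends u)

∈-ends : {u w : Fin n} (e : Edge n) → w ∈ ends u e → Joins u w e
∈-ends {u = u} e w∈ with src e Fin.≟ u | tgt e Fin.≟ u | w∈
... | yes p | _     | here refl         = inj₁ (sym p , refl)
... | yes p | yes q | there (here refl) = inj₂ (sym q , refl)
... | no _  | yes q | here refl         = inj₂ (sym q , refl)

ends-⊆ : {u w : Fin n} (e : Edge n) → Joins u w e → [ w ] ⊆ ends u e
ends-⊆ e (inj₁ (refl , refl)) with src e Fin.≟ src e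
... | yes _ = refl ∷ Sub.minimum _
... | no ¬p = contradiction refl ¬p
ends-⊆ e (inj₂ (refl , refl)) with tgt e Fin.≟ tgt e
... | yes _ = Sublist.++ˡ (if does (src e Fin.≟ tgt e) then [ tgt e ] else []) (refl ∷ [])
... | no ¬p = contradiction refl ¬p

ends-unique : (u : Fin n) (e : Edge n) → Unique (ends u e)
ends-unique u e with src e Fin.≟ u | tgt e Fin.≟ u
... | yes p | yes q = contradiction (trans p (sym q)) (src≢tgt e)
... | yes _ | no _  = [] ∷ []
... | no _  | yes _ = [] ∷ []
... | no _  | no _  = []

⊆-neighbours : {u : Fin n} {ws : List (Fin n)} {es : List (Edge n)} →
               Sublist (Joins u) ws es → ws ⊆ neighbours u es
⊆-neighbours []            = []
⊆-neighbours {u = u} (e ∷ʳ s)      = Sublist.++ˡ (ends u e) (⊆-neighbours s)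
⊆-neighbours (_∷_ {y = e} j s) = Sublist.++⁺ (ends-⊆ e j) (⊆-neighbours s)

∈-neighbours : {u w : Fin n} {es : List (Edge n)} → w ∈ neighbours u es → Any (Joins u w) es
∈-neighbours {u = u} {es = es} w∈ =
  Any.map (λ {e} → ∈-ends e) (∈-concatMap⁻ (ends u) {xs = es} w∈)

-- A neighbour listed under two edges would make both join the same pair, hence be equal.
neighbours-unique : (u : Fin n) {es : List (Edge n)} → Unique es → Unique (neighbours u es)
neighbours-unique u {es} uniq =
  AllPairs.concat⁺ (All.map⁺ (All.universal (ends-unique u) es))
    (AllPairs.map⁺ (AllPairs.map
      (λ {e} {e′} e≢e′ → All.tabulate (λ w∈ → All.tabulate (λ { w∈′ refl →
        e≢e′ (Joins-injective (∈-ends e w∈) (∈-ends e′ w∈′)) })))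
      uniq))

closed : List (Edge n) → Fin n → List (Fin n)
closed es u = u ∷ neighbours u es

closed-unique : {es : List (Edge n)} → Unique es → ∀ u → Unique (closed es u)
closed-unique {es = es} uniq u =
  All.tabulate (λ { w∈ refl → u∉ (∈-neighbours {es = es} w∈) }) ∷ neighbours-unique u uniq
  where
  u∉ : ∀ {es} → ¬ Any (Joins u u) es
  u∉ (here {x = e} j) = Joins-irrefl e j
  u∉ (there p)        = u∉ p

handshake : (es : List (Edge n)) →
            sum (map (λ u → length (neighbours u es)) (allFin n)) ≤ 2 * length es
handshake {n} []       =
  ≤-reflexive (trans (sum-map-const 0 (allFin n)) (*-zeroʳ (length (allFin n))))
handshake {n} (e ∷ es) = begin
  sum (map (λ u → length (neighbours u (e ∷ es))) (allFin n))
    ≤⟨ sum-map-bump (src e) (at-src (src e)) off-src (Unique.allFin⁺ n) ⟩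
  suc (sum (map h (allFin n)))
    ≤⟨ s≤s (sum-map-bump (tgt e) (at-tgt (tgt e)) off-tgt (Unique.allFin⁺ n)) ⟩
  suc (suc (sum (map (λ u → length (neighbours u es)) (allFin n))))
    ≤⟨ s≤s (s≤s (handshake es)) ⟩
  2 + 2 * length es
    ≡⟨ *-suc 2 (length es) ⟨
  2 * suc (length es) ∎
  where
  open ≤-Reasoning
  -- `h` counts `e` only at its end `tgt e`, so each of the two comparisons differs at a single
  -- vertex.
  h : Fin n → ℕ
  h u = length ((if does (tgt e Fin.≟ u) then [ src e ] else []) ++ neighbours u es)

  at-src : ∀ u → length (neighbours u (e ∷ es)) ≤ suc (h u)
  at-src u with does (src e Fin.≟ u)
  ... | true  = ≤-refl
  ... | false = n≤1+n _
  off-src : ∀ {u} → src e ≢ u → length (neighbours u (e ∷ es)) ≤ h u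
  off-src {u} ≢u with src e Fin.≟ u
  ... | yes ≡u = contradiction ≡u ≢u
  ... | no _   = ≤-refl
  at-tgt : ∀ u → h u ≤ suc (length (neighbours u es))
  at-tgt u with does (tgt e Fin.≟ u)
  ... | true  = ≤-refl
  ... | false = n≤1+n _
  off-tgt : ∀ {u} → tgt e ≢ u → h u ≤ length (neighbours u es)
  off-tgt {u} ≢u with tgt e Fin.≟ u
  ... | yes ≡u = contradiction ≡u ≢u
  ... | no _   = ≤-refl

adjacent⇒∈-neighbours : {u v : Fin n} {es : List (Edge n)} →
                        Adjacent es u v → u ∈ neighbours v es
adjacent⇒∈-neighbours         (here {x = e} j)  = ∈-++⁺ˡ (Sub.to∈ (ends-⊆ e (Joins-sym e j)))
adjacent⇒∈-neighbours {v = v} (there {x = e} p) = ∈-++⁺ʳ (ends v e) (adjacent⇒∈-neighbours p)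

-- A vertex has rank zero in no closed neighbourhood but its own, so adjacent
-- vertices clash as well.
closed-clash : ∀ {es : List (Edge n)} {q} → Unique es →
               (∀ {u v} → u ≢ v → ¬ Adjacent es u v → Crossing es u v) →
               ∀ {u v} → u ≢ v → length (closed es u) ≤ q → length (closed es v) ≤ q →
               ∃ λ z → Clash (rank q (closed es u) z) (rank q (closed es v) z)
closed-clash {es = es} uniq cross {u} {v} u≢v lu@(s≤s {n = q} _) lv@(s≤s lv′)
  with Any.any? (joins? u v) es
... | yes adj with b , eq ← ∈⇒rank lv′ (adjacent⇒∈-neighbours adj) =
  u , zero , suc b , rank-head q _ u , rank-∷-≢ q (u≢v ∘ sym) eq , λ ()
... | no ¬adj with w , w′ , s , s′ ← cross u≢v ¬adj =
  crossing⇒clash (closed-unique uniq u) (closed-unique uniq v) lu lv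
    (u ∷ʳ ⊆-neighbours s) (v ∷ʳ ⊆-neighbours s′)

-- From pairwise crossings to many edges.

length*≤sum+filter : (f : Fin n → ℕ) {q : ℕ} (low? : Decidable (λ u → f u < q))
                     (us : List (Fin n)) →
                     length us * q ≤ sum (map f us) + length (filter low? us) * q
length*≤sum+filter f         low? []       = z≤n
length*≤sum+filter f {q} low? (u ∷ us) with low? u | length*≤sum+filter f low? us
... | no ≰q | ih = ≤-trans (+-mono-≤ (≮⇒≥ ≰q) ih) (≤-reflexive (sym (+-assoc (f u) _ _)))
... | yes _ | ih = begin
  q + length us * q          ≤⟨ +-monoʳ-≤ q ih ⟩
  q + (s + l * q)            ≤⟨ +-monoʳ-≤ q (m≤n+m _ (f u)) ⟩
  q + (f u + (s + l * q))    ≡⟨ shuffle q (f u) s (l * q) ⟩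
  f u + s + (q + l * q)      ∎
  where
  open ≤-Reasoning
  s = sum (map f us)
  l = length (filter low? us)
  shuffle : ∀ a b c d → a + (b + (c + d)) ≡ b + c + (a + d)
  shuffle = solve-∀

-- Vertices of degree below `q` have closed neighbourhoods of length at most `q`, and these clash
-- pairwise, so there are at most `q ^ q` of them. All others contribute at least `q` to the degree
-- sum.
crossing⇒many-edges : ∀ {es : List (Edge n)} → Unique es →
                      (∀ {u v} → u ≢ v → ¬ Adjacent es u v → Crossing es u v) →
                      ∀ q .{{_ : NonZero q}} → n * q ≤ 2 * length es + q ^ q * q
crossing⇒many-edges {n} {es} uniq cross q = begin
  n * q                                            ≡⟨ cong (_* q) (length-tabulate {n = n} id) ⟨
  length (allFin n) * q                            ≤⟨ length*≤sum+filter deg low? (allFin n) ⟩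
  sum (map deg (allFin n)) + length low * q        ≤⟨ +-mono-≤ (handshake es) (*-monoˡ-≤ q few) ⟩
  2 * length es + q ^ q * q                        ∎
  where
  open ≤-Reasoning
  deg : Fin n → ℕ
  deg u = length (neighbours u es)
  low? : Decidable (λ u → suc (deg u) ≤ q)
  low? u = suc (deg u) ≤? q
  low : List (Fin n)
  low = filter low? (allFin n)
  is-low : All (λ u → suc (deg u) ≤ q) low
  is-low = All.all-filter low? (allFin n)
  few : length low ≤ q ^ q
  few = few-short-lists (closed es) q low is-low
    (allPairs-refine (λ lu lv u≢v → closed-clash uniq cross u≢v lu lv) is-low
      (AllPairs.filter⁺ low? (Unique.allFin⁺ n)))

n<2^n : ∀ n → n < 2 ^ n
n<2^n zero    = ≤-refl
n<2^n (suc n) = begin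
  suc (suc n)       ≤⟨ s≤s (m≤n+m (suc n) n) ⟩
  suc n + suc n     ≤⟨ +-mono-≤ (n<2^n n) (n<2^n n) ⟩
  2 ^ n + 2 ^ n     ≡⟨ cong (2 ^ n +_) (+-identityʳ _) ⟨
  2 ^ suc n         ∎
  where open ≤-Reasoning

-- With `q = p + 1 ≤ 2 ^ p`, the power `q ^ q` is at most `2 ^ (p * q)`, and the remaining exponent
-- `q` pays for the factor 2.
2*q^q≤2^[q*q] : ∀ q .{{_ : NonZero q}} → 2 * q ^ q ≤ 2 ^ (q * q)
2*q^q≤2^[q*q] (suc p) = begin
  2 * suc p ^ suc p            ≤⟨ *-monoʳ-≤ 2 (^-monoˡ-≤ (suc p) (n<2^n p)) ⟩
  2 * (2 ^ p) ^ suc p          ≡⟨ cong (2 *_) (^-*-assoc 2 p (suc p)) ⟩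
  2 ^ suc (p * suc p)          ≤⟨ ^-monoʳ-≤ 2 (s≤s (m≤n+m _ p)) ⟩
  2 ^ (suc p * suc p)          ∎
  where open ≤-Reasoning

-- `q` is the integer part of the square root of the binary logarithm of `suc n`.
square-bracket : ∀ n → ∃ λ q → 2 ^ (q * q) ≤ suc n × suc n < 2 ^ (suc q * suc q)
square-bracket zero    = 0 , s≤s z≤n , s≤s (s≤s z≤n)
square-bracket (suc n) with square-bracket n
... | q , lo , hi with suc (suc n) <? 2 ^ (suc q * suc q)
...   | yes hi′ = q , m≤n⇒m≤1+n lo , hi′
...   | no ≮    =
  suc q , ≮⇒≥ ≮ , <-≤-trans (s<s hi)
    (^-monoʳ-< 2 (s≤s (s≤s z≤n)) (*-mono-< (n<1+n (suc q)) (n<1+n (suc q))))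

crossing⇒n√log-n : ∀ {es : List (Edge n)} → 2 ≤ n → Unique es →
                   (∀ {u v} → u ≢ v → ¬ Adjacent es u v → Crossing es u v) →
                   n ^ 2 * ⌈log₂ n ⌉ ≤ (8 * length es) ^ 2
crossing⇒n√log-n {n@(suc n-1)} {es} 2≤n uniq cross with square-bracket n-1
-- `q = 0` would give `n < 2`.
... | zero , lo , hi = contradiction hi (≤⇒≯ 2≤n)
... | q@(suc _) , lo , hi = begin
  n ^ 2 * ⌈log₂ n ⌉            ≤⟨ *-monoʳ-≤ (n ^ 2) log≤ ⟩
  n ^ 2 * (suc q * suc q)      ≤⟨ *-monoʳ-≤ (n ^ 2) (*-mono-≤ 1+q≤ 1+q≤) ⟩
  n ^ 2 * (2 * q * (2 * q))    ≡⟨ square n q ⟩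
  (2 * (n * q)) ^ 2            ≤⟨ ^-monoˡ-≤ 2 (*-monoʳ-≤ 2 nq≤4e) ⟩
  (2 * (4 * length es)) ^ 2    ≡⟨ cong (_^ 2) (*-assoc 2 4 (length es)) ⟨
  (8 * length es) ^ 2          ∎
  where
  open ≤-Reasoning
  square : ∀ n q → n * (n * 1) * (2 * q * (2 * q)) ≡ 2 * (n * q) * (2 * (n * q) * 1)
  square = solve-∀
  double : ∀ e p q → 2 * (2 * e + p * q) ≡ 4 * e + 2 * p * q
  double = solve-∀
  log≤ : ⌈log₂ n ⌉ ≤ suc q * suc q
  log≤ = ≤-trans (⌈log₂⌉-mono-≤ (<⇒≤ hi)) (≤-reflexive (⌈log₂2^n⌉≡n (suc q * suc q)))
  1+q≤ : suc q ≤ 2 * q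
  1+q≤ = ≤-trans (+-monoˡ-≤ q (s≤s z≤n)) (≤-reflexive (cong (q +_) (sym (+-identityʳ q))))
  -- Since `2 * q ^ q ≤ n`, the low vertices account for at most half of `n * q`.
  nq≤4e : n * q ≤ 4 * length es
  nq≤4e = +-cancelʳ-≤ (n * q) _ _ (begin
    n * q + n * q                  ≡⟨ cong (n * q +_) (+-identityʳ _) ⟨
    2 * (n * q)                    ≤⟨ *-monoʳ-≤ 2 (crossing⇒many-edges uniq cross q) ⟩
    2 * (2 * length es + q ^ q * q) ≡⟨ double (length es) (q ^ q) q ⟩
    4 * length es + 2 * q ^ q * q
      ≤⟨ +-monoʳ-≤ (4 * length es) (*-monoˡ-≤ q (≤-trans (2*q^q≤2^[q*q] q) lo)) ⟩
    4 * length es + n * q          ∎)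

-- Crossing edge orders of complete graphs

Ascent : List (Edge n) → Fin n → Set
Ascent es v = ∃₂ λ a b → a Fin.< b × Sublist (Joins v) (a ∷ b ∷ []) es

-- `ascent` strengthens the induction: it supplies the crossings with each newly added vertex.
record CrossingOrder (k : ℕ) : Set where
  field
    order    : List (Edge k)
    distinct : Unique order
    complete : ∀ {u v} → u ≢ v → Adjacent order u v
    crossing : ∀ {u v} → u ≢ v → Crossing order u v
    ascent   : ∀ v → Ascent order v

crossingOrder₄ : CrossingOrder 4
crossingOrder₄ = record
  { order    = matchings
  ; distinct = from-yes (AllPairs.allPairs? (λ e f → ¬? (e ≟ₑ f)) matchings)
  ; complete = λ {u} {v} → from-yes (Fin.all? λ u → Fin.all? λ v →
      ¬? (u Fin.≟ v) →-dec Any.any? (joins? u v) matchings) u v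
  ; crossing = λ {u} {v} → from-yes (Fin.all? λ u → Fin.all? λ v →
      ¬? (u Fin.≟ v) →-dec Fin.any? λ w → Fin.any? λ w′ →
        row? u (w ∷ w′ ∷ []) ×-dec row? v (w′ ∷ w ∷ [])) u v
  ; ascent   = from-yes (Fin.all? λ v → Fin.any? λ a → Fin.any? λ b →
      a Fin.<? b ×-dec row? v (a ∷ b ∷ []))
  }
  where
  -- The three perfect matchings of K₄, one after the other.
  matchings : List (Edge 4)
  matchings = edge 0F 2F z<s ∷ edge 1F 3F (s<s z<s) ∷ edge 0F 1F z<s ∷
       edge 2F 3F (s<s (s<s z<s)) ∷ edge 0F 3F z<s ∷ edge 1F 2F (s<s z<s) ∷ []
  row? : ∀ v ws → Dec (Sublist (Joins v) ws matchings)
  row? v ws = Sublist.sublist? (joins? v) ws matchings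

spoke : Fin k → Edge (suc k)
spoke i = edge zero (suc i) z<s

star : ∀ k → List (Edge (suc k))
star k = tabulate {n = k} spoke

lift : Edge k → Edge (suc k)
lift (edge u v u<v) = edge (suc u) (suc v) (s<s u<v)

tabulate-sublist₂ : {A B : Set} {R : A → B → Set} {x y : A} (f : Fin k → B) {a b : Fin k} →
                    a Fin.< b → R x (f a) → R y (f b) → Sublist R (x ∷ y ∷ []) (tabulate f)
tabulate-sublist₂ f {zero}  {suc b} _   r r′ = r ∷ Sublist.fromAny (Any.tabulate⁺ b r′)
tabulate-sublist₂ f {suc a} {suc b} a<b r r′ =
  f zero ∷ʳ tabulate-sublist₂ (f ∘ suc) (s<s⁻¹ a<b) r r′

Unique-reverse : {es : List (Edge n)} → Unique es → Unique (reverse es)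
Unique-reverse {n} {es} = Unique-resp-↭ (↭-sym (↭-reverse es))
  where
  open Permutation (setoid (Edge n)) using (↭-sym)
  open PermutationProperties (setoid (Edge n)) using (Unique-resp-↭; ↭-reverse)

lift-row : {u : Fin k} {ws : List (Fin k)} {es : List (Edge k)} → Sublist (Joins u) ws es →
           Sublist (Joins (suc u)) (map suc ws) (map lift es)
lift-row = Sublist.map⁺ suc lift ∘ Sublist.map λ {_} {e} j →
  Joins-maps {e = e} {e′ = lift e} j (inj₁ (refl , refl))

-- The reversal turns the ascent of an old vertex into a descent, which crosses
-- the ascending row of the new vertex zero; edges to zero being first, every
-- vertex has an ascent again.
extend : CrossingOrder (2 + k) → CrossingOrder (3 + k)
extend {k} O = record
  { order    = star K ++ old
  ; distinct = Unique.++⁺ (Unique.tabulate⁺ {f = spoke} (λ { refl → refl }))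
                 (Unique-reverse (Unique.map⁺ lift-injective distinct))
                 (λ {e} (p , q) → disjoint {e} p q)
  ; complete = λ {u} {v} → complete′ u v
  ; crossing = λ {u} {v} → crossing′ u v
  ; ascent   = ascent′
  }
  where
  open CrossingOrder O
  K : ℕ
  K = 2 + k
  old : List (Edge (suc K))
  old = reverse (map lift order)

  lift-injective : {e f : Edge K} → lift e ≡ lift f → e ≡ f
  lift-injective refl = refl

  disjoint : ∀ {e} → e ∈ star K → e ∉ old
  disjoint p q with ∈-tabulate⁻ {f = spoke} p | ∈-map⁻ lift (Any.reverse⁻ {xs = map lift order} q)
  ... | _ , refl | _ , _ , ()

  star-adjacent : ∀ v → Adjacent (star K) zero (suc v)
  star-adjacent v = Any.tabulate⁺ {f = spoke} v (inj₁ (refl , refl))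

  star-row : ∀ {a b} → a Fin.< b → Sublist (Joins zero) (suc a ∷ suc b ∷ []) (star K ++ old)
  star-row a<b =
    Sublist.++ʳ old (tabulate-sublist₂ spoke a<b (inj₁ (refl , refl)) (inj₁ (refl , refl)))

  old-row : ∀ {u w w′} → Sublist (Joins u) (w ∷ w′ ∷ []) order →
            Sublist (Joins (suc u)) (suc w′ ∷ suc w ∷ []) (star K ++ old)
  old-row s = Sublist.++ˡ (star K) (Sublist.reverse⁺ (lift-row s))

  complete′ : ∀ u v → u ≢ v → Adjacent (star K ++ old) u v
  complete′ zero    zero    u≢v = contradiction refl u≢v
  complete′ zero    (suc v) _   = Any.++⁺ˡ (star-adjacent v)
  complete′ (suc u) zero    _   = Any.++⁺ˡ (adjacent-sym (star-adjacent u))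
  complete′ (suc u) (suc v) u≢v = Any.++⁺ʳ (star K) (Any.reverse⁺ (Sublist.toAny (lift-row
    (Sublist.fromAny (complete (u≢v ∘ cong suc))))))

  cross-zero : ∀ w → Crossing (star K ++ old) zero (suc w)
  cross-zero w with a , b , a<b , s ← ascent w = suc a , suc b , star-row a<b , old-row s

  crossing′ : ∀ u v → u ≢ v → Crossing (star K ++ old) u v
  crossing′ zero    zero    u≢v = contradiction refl u≢v
  crossing′ zero    (suc v) _   = cross-zero v
  crossing′ (suc u) zero    _   = Crossing-sym {es = star K ++ old} (cross-zero u)
  -- Reversal turns both old rows round, so the old witnesses serve in swapped order.
  crossing′ (suc u) (suc v) u≢v with w , w′ , s , s′ ← crossing (u≢v ∘ cong suc) =
    suc w′ , suc w , old-row s , old-row s′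

  ascent′ : ∀ v → Ascent (star K ++ old) v
  -- Two old vertices are required here, hence the `2 + k`.
  ascent′ zero    = 1F , 2F , s<s z<s , star-row z<s
  ascent′ (suc v) with a , _ , _ , s ← ascent v =
    zero , suc a , z<s ,
    Sublist.++⁺ (Sublist.fromAny (adjacent-sym (star-adjacent v)))
      (Sublist.fromAny (Any.reverse⁺ (Sublist.toAny (lift-row s))))

crossingOrder : ∀ j → CrossingOrder (4 + j)
crossingOrder zero    = crossingOrder₄
crossingOrder (suc j) = extend (crossingOrder j)

-- The roles of an inserted edge

relabel : {A B C : Set} {R : B → C → Set} (f : A → B) {as : List A} {cs : List C} →
          Sublist (R ∘ f) as cs → Sublist R (map f as) cs
relabel f []       = []
relabel f (c ∷ʳ s) = c ∷ʳ relabel f s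
relabel f (r ∷ s)  = r ∷ relabel f s

-- Locates the role of an inserted edge `y`: either the copy avoids it, or `x` is the edge that it
-- plays and the copy splits there.
split-sublist : {A B : Set} {R : A → B → Set} {xs : List A} (ys : List B) {y : B} {zs : List B} →
                Sublist R xs (ys ++ y ∷ zs) →
                Sublist R xs (ys ++ zs) ⊎
                (∃ λ xs₁ → ∃₂ λ x xs₂ → xs ≡ xs₁ ++ x ∷ xs₂ ×
                  Sublist R xs₁ ys × R x y × Sublist R xs₂ zs)
split-sublist []       (y ∷ʳ s) = inj₁ s
split-sublist []       (r ∷ s)  = inj₂ ([] , _ , _ , refl , [] , r , s)
split-sublist (y ∷ ys) (.y ∷ʳ s) with split-sublist ys s
... | inj₁ s′                                  = inj₁ (y ∷ʳ s′)
... | inj₂ (xs₁ , x , xs₂ , eq , s₁ , r , s₂) = inj₂ (xs₁ , x , xs₂ , eq , y ∷ʳ s₁ , r , s₂)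
split-sublist (y ∷ ys) (r ∷ s) with split-sublist ys s
... | inj₁ s′                                   = inj₁ (r ∷ s′)
... | inj₂ (xs₁ , x , xs₂ , eq , s₁ , r′ , s₂) =
  inj₂ (_ ∷ xs₁ , x , xs₂ , cong (_ ∷_) eq , r ∷ s₁ , r′ , s₂)

++-disjoint : {A : Set} {x : A} (xs : List A) {ys : List A} → Unique (xs ++ ys) → x ∈ xs → x ∉ ys
++-disjoint (_ ∷ xs) (x∉ ∷ _) (here refl) x∈ys = All.lookup x∉ (∈-++⁺ʳ xs x∈ys) refl
++-disjoint (_ ∷ xs) (_ ∷ u)  (there x∈)  x∈ys = ++-disjoint xs u x∈ x∈ys

-- Separates the role of `eₘₐₓ`, the final entry, from the roles inside `G`.
++-middle : {A : Set} (ws : List A) {z : A} {xs : List A} {x : A} {ys : List A} →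
            ws ++ [ z ] ≡ xs ++ x ∷ ys → ws ≡ xs ⊎ x ∈ ws
++-middle []           {xs = []}          eq = inj₁ refl
++-middle (w ∷ ws)     {xs = []}          refl = inj₂ (here refl)
++-middle []           {xs = _ ∷ []}     ()
++-middle []           {xs = _ ∷ _ ∷ _} ()
++-middle (w ∷ ws)     {xs = x ∷ xs}      eq with ∷-injective eq
... | refl , eq′ = Sum.map (cong (w ∷_)) there (++-middle ws eq′)

insertAt-++ : {A : Set} (pre : List A) {post : List A} (e : A) →
              ∃ λ i → insertAt (pre ++ post) i e ≡ pre ++ e ∷ post
insertAt-++ []        e = zero , refl
insertAt-++ (x ∷ pre) e with i , eq ← insertAt-++ pre e = suc i , cong (x ∷_) eq

sublist-++⁻ˡ : {A B : Set} {R : A → B → Set} {xs ys : List A} {zs : List B} →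
               Sublist R (xs ++ ys) zs → Sublist R xs zs
sublist-++⁻ˡ {xs = []}     s        = Sublist.minimum _
sublist-++⁻ˡ {xs = _ ∷ _} (z ∷ʳ s) = z ∷ʳ sublist-++⁻ˡ s
sublist-++⁻ˡ {xs = _ ∷ _} (r ∷ s)  = r ∷ sublist-++⁻ˡ s

ends-satisfy : {P : Fin n → Set} {u v : Fin n} (e : Edge n) →
               P (src e) × P (tgt e) → Joins u v e → P u
ends-satisfy e (s , _) (inj₁ (refl , _)) = s
ends-satisfy e (_ , t) (inj₂ (refl , _)) = t

infix 4 _↪_

-- `Contains` for bare edge lists: segments of an edge order and truncations of the forbidden graph
-- then carry no proofs of uniqueness.
_↪_ : List (Edge m) → List (Edge n) → Set
_↪_ {m} {n} fs es = Σ[ φ ∈ (Fin m → Fin n) ] Injective _≡_ _≡_ φ × Sublist (Maps φ) fs es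

module _ (O : CrossingOrder k) where

  open CrossingOrder O renaming (order to g)

  -- The truncations `head+` and `+last` keep all `4 + k` vertices; the ends of the dropped edge
  -- still have images, but these need not be adjacent.
  head+ : List (Edge (4 + k))
  head+ = e₀ ∷ map shift g

  +last : List (Edge (4 + k))
  +last = map shift g ++ [ eₘₐₓ ]

  -- The entries stay vertices of `G`, so that `inner-row` can compare them with `b` after
  -- splitting.
  image-row : {φ : Fin (4 + k) → Fin n} {es : List (Edge n)} {u : Fin k} {ws : List (Fin k)} →
              Sublist (Maps φ) (map shift g) es → Sublist (Joins u) ws g →
              Sublist (λ w → Joins (φ (4 ↑ʳ u)) (φ (4 ↑ʳ w))) ws es
  image-row {φ = φ} {u = u} s r = Sublist.trans {S = λ e → Maps φ (shift e)}
    (λ {w} {e} {e′} j mp → Joins-maps {φ = φ ∘ (4 ↑ʳ_)} {e = e} {e′ = e′} j mp) r (unmap s)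
    where
    unmap : ∀ {g es} → Sublist (Maps φ) (map shift g) es → Sublist (λ e → Maps φ (shift e)) g es
    unmap {[]}    s        = Sublist.minimum _
    unmap {_ ∷ _} (e ∷ʳ s) = e ∷ʳ unmap s
    unmap {_ ∷ _} (r ∷ s)  = r ∷ unmap s

  image-edge : {φ : Fin (4 + k) → Fin n} {es : List (Edge n)} {a b : Fin k} →
               Sublist (Maps φ) (map shift g) es → Adjacent g a b →
               Adjacent es (φ (4 ↑ʳ a)) (φ (4 ↑ʳ b))
  image-edge s adj = Sublist.toAny (image-row s (Sublist.fromAny adj))

  data Touched (ψ : Fin (4 + k) → Fin n) (v : Fin n) : Set where
    at-e₀ : v ≡ ψ 0F ⊎ v ≡ ψ 1F → Touched ψ v
    at-G  : ∀ a → ψ (4 ↑ʳ a) ≡ v → Touched ψ v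

  -- Redirect `ψ` at the ends `2F` and `3F` of `eₘₐₓ`, which `head+` leaves free, to `p` and `q`. As
  -- these are untouched the map stays injective, and the edge joining them comes after all of `as`.
  attach-last : {ψ : Fin (4 + k) → Fin n} → Injective _≡_ _≡_ ψ →
                {as bs : List (Edge n)} → Sublist (Maps ψ) head+ as →
                ∀ {p q} → p ≢ q → Adjacent bs p q → ¬ Touched ψ p → ¬ Touched ψ q →
                (e₀ ∷ +last) ↪ (as ++ bs)
  attach-last {n} {ψ} ψ-inj s {p} {q} p≢q adj ¬p ¬q =
    χ , χ-inj , Sublist.++⁺ (head s) (Sublist.fromAny adj)
    where
    χ : Fin (4 + k) → Fin n
    χ 0F = ψ 0F
    χ 1F = ψ 1F
    χ 2F = p
    χ 3F = q
    χ (suc (suc (suc (suc a)))) = ψ (4 ↑ʳ a)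

    tail : ∀ g {es} → Sublist (Maps ψ) (map shift g) es → Sublist (Maps χ) (map shift g) es
    tail []      s        = Sublist.minimum _
    tail (f ∷ g) (e ∷ʳ s) = e ∷ʳ tail (f ∷ g) s
    tail (f ∷ g) (r ∷ s)  = r ∷ tail g s
    head : ∀ {es} → Sublist (Maps ψ) head+ es → Sublist (Maps χ) head+ es
    head (e ∷ʳ s) = e ∷ʳ head s
    head (r ∷ s)  = r ∷ tail g s

    data View : Fin (4 + k) → Set where
      old  : ∀ {x} → χ x ≡ ψ x → Touched ψ (ψ x) → View x
      is-2 : View 2F
      is-3 : View 3F
    view : ∀ x → View x
    view 0F = old refl (at-e₀ (inj₁ refl))
    view 1F = old refl (at-e₀ (inj₂ refl))
    view 2F = is-2
    view 3F = is-3
    view (suc (suc (suc (suc a)))) = old refl (at-G a refl)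

    χ-inj : Injective _≡_ _≡_ χ
    χ-inj {x} {y} eq with view x | view y
    ... | old ex _ | old ey _ = ψ-inj (trans (sym ex) (trans eq ey))
    ... | old ex t | is-2     = contradiction (subst (Touched ψ) (trans (sym ex) eq) t) ¬p
    ... | old ex t | is-3     = contradiction (subst (Touched ψ) (trans (sym ex) eq) t) ¬q
    ... | is-2     | old ey t = contradiction (subst (Touched ψ) (trans (sym ey) (sym eq)) t) ¬p
    ... | is-3     | old ey t = contradiction (subst (Touched ψ) (trans (sym ey) (sym eq)) t) ¬q
    ... | is-2     | is-2     = refl
    ... | is-3     | is-3     = refl
    ... | is-2     | is-3     = contradiction eq p≢q
    ... | is-3     | is-2     = contradiction (sym eq) p≢q

  image-touched : {ψ : Fin (4 + k) → Fin n} {f : Edge (4 + k)} {e : Edge n} → f ∈ head+ →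
                  Maps ψ f e → Touched ψ (src e) × Touched ψ (tgt e)
  image-touched (here refl) (inj₁ (p , q)) = at-e₀ (inj₁ (sym p)) , at-e₀ (inj₂ (sym q))
  image-touched (here refl) (inj₂ (p , q)) = at-e₀ (inj₂ (sym q)) , at-e₀ (inj₁ (sym p))
  image-touched (there f∈) mp with ∈-map⁻ shift f∈
  ... | f , _ , refl with mp
  ...   | inj₁ (p , q) = at-G (src f) p , at-G (tgt f) q
  ...   | inj₂ (p , q) = at-G (tgt f) q , at-G (src f) p

  -- The vertices of the late copy of G fall into four classes, none of which has
  -- two elements, because of the edge z of the late copy that would join them. In
  -- class 0 z would be the early e₀; class 1 is the single vertex src y; in class 2
  -- z would lie in both copies of G, hence be y; in class 3 z would complete the
  -- early copy as its eₘₐₓ.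
  late⇒¬early : 5 ≤ k → {pre : List (Edge n)} {y : Edge n} {post : List (Edge n)} →
    Unique (pre ++ y ∷ post) →
    ¬ ((e₀ ∷ +last) ↪ (pre ++ y ∷ post)) →
    {φ ψ : Fin (4 + k) → Fin n} → Injective _≡_ _≡_ φ → Injective _≡_ _≡_ ψ →
    Sublist (Maps φ) +last (y ∷ post) → ¬ Sublist (Maps ψ) head+ (pre ++ [ y ])
  late⇒¬early {n} 5≤k {pre} {y} {post} uniq free {φ} {ψ} φ-inj ψ-inj late early
    = separate (Fin.pigeonhole 5≤k (proj₁ ∘ class))
    where
    v : Fin k → Fin n
    v a = φ (4 ↑ʳ a)

    Class : Fin k → Fin 4 → Set
    Class a 0F = v a ≡ ψ 0F ⊎ v a ≡ ψ 1F
    Class a 1F = v a ≡ src y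
    Class a 2F = v a ≢ src y × ∃ λ b → ψ (4 ↑ʳ b) ≡ v a
    Class a 3F = ¬ Touched ψ (v a)

    class : ∀ a → ∃ (Class a)
    class a with (v a Fin.≟ ψ 0F) ⊎-dec (v a Fin.≟ ψ 1F) | v a Fin.≟ src y
               | Fin.any? (λ b → ψ (4 ↑ʳ b) Fin.≟ v a)
    ... | yes p | _     | _     = 0F , p
    ... | no _  | yes p | _     = 1F , p
    ... | no _  | no ¬p | yes p = 2F , ¬p , p
    ... | no ¬p | no _  | no ¬q = 3F , λ { (at-e₀ p) → ¬p p ; (at-G b p) → ¬q (b , p) }

    v≢ : ∀ {a b} → a ≢ b → v a ≢ v b
    v≢ a≢b eq = a≢b (Fin.↑ʳ-injective 4 _ _ (φ-inj eq))

    late-edge : ∀ {a b} → a ≢ b → Adjacent (y ∷ post) (v a) (v b)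
    late-edge a≢b = image-edge (sublist-++⁻ˡ late) (complete a≢b)

    early-split : Sublist (Maps ψ) head+ pre ⊎ (Touched ψ (src y) × Touched ψ (tgt y))
    early-split with split-sublist pre early
    ... | inj₁ s = inj₁ (subst (Sublist (Maps ψ) head+) (++-identityʳ pre) s)
    ... | inj₂ (xs₁ , x , xs₂ , eq , _ , mp , _) =
      inj₂ (image-touched {f = x} {e = y} (subst (x ∈_) (sym eq) (∈-++⁺ʳ xs₁ (here refl))) mp)

    early-e₀ : ∀ {a b : Fin k} → a ≢ b → Adjacent pre (ψ 0F) (ψ 1F)
    early-e₀ a≢b with split-sublist pre early
    ... | inj₁ s = Sublist.toAny (subst (Sublist (Maps ψ) head+) (++-identityʳ pre) s)
    -- If `y` played `e₀`, then `G`, which has an edge between `a` and `b`, would embed into the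
    -- empty list after it.
    ... | inj₂ ([] , _ , _ , refl , _ , _ , s)  = contradiction (image-edge s (complete a≢b)) λ ()
    ... | inj₂ (_ ∷ _ , _ , _ , eq , s , _ , _) with ∷-injective eq
    ...   | refl , _ = Sublist.toAny s

    not-both : ∀ {p q} → Adjacent pre p q → ¬ Adjacent (y ∷ post) p q
    not-both adj adj′ with find adj | find adj′
    ... | e , e∈ , j | e′ , e′∈ , j′ with refl ← Joins-injective {e = e} {e′} j j′ =
      ++-disjoint pre uniq e∈ e′∈

    alone : ∀ c {a b} → a ≢ b → Class a c → Class b c → ⊥
    alone 0F a≢b (inj₁ p) (inj₁ q) = v≢ a≢b (trans p (sym q))
    alone 0F a≢b (inj₂ p) (inj₂ q) = v≢ a≢b (trans p (sym q))
    alone 0F a≢b (inj₁ p) (inj₂ q) =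
      not-both (early-e₀ a≢b) (subst₂ (Adjacent (y ∷ post)) p q (late-edge a≢b))
    alone 0F a≢b (inj₂ p) (inj₁ q) =
      not-both (early-e₀ a≢b) (adjacent-sym (subst₂ (Adjacent (y ∷ post)) p q (late-edge a≢b)))
    alone 1F a≢b p q = v≢ a≢b (trans p (sym q))
    -- The early copy has an edge between these two vertices. In `pre` it would repeat the late one;
    -- as `y` it would make one of them `src y`.
    alone 2F {a} {b} a≢b (va≢ , a′ , eqa) (vb≢ , b′ , eqb)
      with Any.++⁻ pre (subst₂ (Adjacent (pre ++ [ y ])) eqa eqb
             (image-edge (Sublist.∷ˡ⁻ early) (complete λ { refl → v≢ a≢b (trans (sym eqa) eqb) })))
    ... | inj₁ adj                   = not-both adj (late-edge a≢b)
    ... | inj₂ (here (inj₁ (p , _))) = va≢ p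
    ... | inj₂ (here (inj₂ (_ , q))) = vb≢ q
    -- If the early copy uses `y`, the ends of `y` are touched, so the late edge lies in `post`,
    -- after the whole early copy.
    alone 3F {a} {b} a≢b ¬ta ¬tb with early-split | late-edge a≢b
    ... | inj₁ s | adj       = free (attach-last ψ-inj s (v≢ a≢b) adj ¬ta ¬tb)
    ... | inj₂ t | here j    = ¬ta (ends-satisfy {P = Touched ψ} y t j)
    ... | inj₂ _ | there adj with attach-last ψ-inj early (v≢ a≢b) adj ¬ta ¬tb
    ...   | χ , χ-inj , s = free (χ , χ-inj ,
      subst (Sublist (Maps χ) (e₀ ∷ +last)) (++-assoc pre [ y ] post) s)

    separate : (∃₂ λ a b → a Fin.< b × proj₁ (class a) ≡ proj₁ (class b)) → ⊥
    separate (a , b , a<b , eq) =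
      alone _ (Fin.<⇒≢ a<b) (subst (Class a) eq (proj₂ (class a))) (proj₂ (class b))

  -- When `e` plays the edge `ab`, a row of `a` that avoids `b` does not use `e`, so it survives the
  -- removal of `e`.
  inner-row : {φ : Fin (4 + k) → Fin n} → Injective _≡_ _≡_ φ →
              {pre post : List (Edge n)} {e : Edge n} →
              Sublist (Maps φ) (e₀ ∷ +last) (pre ++ e ∷ post) →
              ∀ {a b ws} → Joins (φ (4 ↑ʳ a)) (φ (4 ↑ʳ b)) e → b ∉ ws → Sublist (Joins a) ws g →
              Sublist (Joins (φ (4 ↑ʳ a))) (map (φ ∘ (4 ↑ʳ_)) ws) (pre ++ post)
  inner-row {φ = φ} φ-inj {pre} {post} {e} copy {b = b} {ws} ab b∉ row
    with split-sublist pre (image-row (sublist-++⁻ˡ (Sublist.∷ˡ⁻ copy)) row)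
  ... | inj₁ s = relabel (φ ∘ (4 ↑ʳ_)) s
  ... | inj₂ (xs₁ , w , xs₂ , eq , _ , j , _) = contradiction b∈ b∉
    where
    b≡w : b ≡ w
    b≡w = Fin.↑ʳ-injective 4 _ _ (φ-inj (Joins-det e ab j))
    b∈ : b ∈ ws
    b∈ = subst₂ _∈_ (sym b≡w) (sym eq) (∈-++⁺ʳ xs₁ (here refl))

  inner-crossing : {φ : Fin (4 + k) → Fin n} → Injective _≡_ _≡_ φ →
                   {pre post : List (Edge n)} {e : Edge n} →
                   Sublist (Maps φ) (e₀ ∷ +last) (pre ++ e ∷ post) →
                   ∀ {a b} → a ≢ b → Joins (φ (4 ↑ʳ a)) (φ (4 ↑ʳ b)) e →
                   Crossing (pre ++ post) (φ (4 ↑ʳ a)) (φ (4 ↑ʳ b))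
  inner-crossing {φ = φ} φ-inj {pre} {post} {e} copy a≢b ab
    with w , w′ , s , s′ ← crossing a≢b =
    φ (4 ↑ʳ w) , φ (4 ↑ʳ w′) ,
    inner-row φ-inj {pre} copy ab (row-∌ s′ ∘ swap∈) s ,
    inner-row φ-inj {pre} copy (Joins-sym e ab) (row-∌ s ∘ swap∈) s′
    where
    swap∈ : ∀ {m} {x y z : Fin m} → x ∈ y ∷ z ∷ [] → x ∈ z ∷ y ∷ []
    swap∈ (here p)         = there (here p)
    swap∈ (there (here p)) = here p

  -- As the graph without `e` is free, the copy uses `e`. Playing `e₀` puts the rest of the copy
  -- into `post`, playing `eₘₐₓ` puts it into `pre`, and an inner role gives a crossing.
  role : {pre post : List (Edge n)} {e : Edge n} {u v : Fin n} → Joins u v e →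
         ¬ ((e₀ ∷ +last) ↪ (pre ++ post)) → (e₀ ∷ +last) ↪ (pre ++ e ∷ post) →
         (+last ↪ post) ⊎ (head+ ↪ pre) ⊎ Crossing (pre ++ post) u v
  role {pre = pre} {post} {e} {u} {v} uv free (φ , φ-inj , copy) with split-sublist pre copy
  ... | inj₁ s = contradiction (φ , (λ {_} {_} → φ-inj) , s) free
  ... | inj₂ ([] , _ , _ , refl , _ , _ , s) = inj₁ (φ , (λ {_} {_} → φ-inj) , s)
  ... | inj₂ (f ∷ xs₁ , x , xs₂ , eq , s , mp , _) with ∷-injective eq
  ...   | refl , eq′ with ++-middle (map shift g) eq′
  ...     | inj₁ refl = inj₂ (inj₁ (φ , (λ {_} {_} → φ-inj) , s))
  ...     | inj₂ x∈ with ∈-map⁻ shift x∈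
  ...       | f′ , _ , refl = inj₂ (inj₂ (orient uv mp))
    where
    orient : Joins u v e → Maps φ (shift f′) e → Crossing (pre ++ post) u v
    orient (inj₁ (refl , refl)) (inj₁ (p , q)) = subst₂ (Crossing (pre ++ post)) p q
      (inner-crossing φ-inj {pre} copy (src≢tgt f′) mp)
    orient (inj₁ (refl , refl)) (inj₂ (p , q)) = subst₂ (Crossing (pre ++ post)) q p
      (inner-crossing φ-inj {pre} copy (src≢tgt f′ ∘ sym) (Joins-sym e mp))
    orient (inj₂ (refl , refl)) (inj₁ (p , q)) = subst₂ (Crossing (pre ++ post)) q p
      (inner-crossing φ-inj {pre} copy (src≢tgt f′ ∘ sym) (Joins-sym e mp))
    orient (inj₂ (refl , refl)) (inj₂ (p , q)) = subst₂ (Crossing (pre ++ post)) p q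
      (inner-crossing φ-inj {pre} copy (src≢tgt f′) mp)

  -- Move the insertion point of e from left to right. As long as e has not played an
  -- inner role it plays e₀: a first switch to eₘₐₓ is excluded by late⇒¬early,
  -- and at the right end nothing is left for G.
  walk : 5 ≤ k → {e : Edge n} {u v : Fin n} → Joins u v e → ∀ pre post → Unique (pre ++ post) →
         ¬ ((e₀ ∷ +last) ↪ (pre ++ post)) →
         (∀ pre′ post′ → pre′ ++ post′ ≡ pre ++ post → (e₀ ∷ +last) ↪ (pre′ ++ e ∷ post′)) →
         +last ↪ post → Crossing (pre ++ post) u v
  walk 5≤k uv pre []         uniq free insert (_ , _ , s) = contradiction s (+last⋢[] g)
    where
    +last⋢[] : ∀ g {R : Edge (4 + k) → Edge _ → Set} → ¬ Sublist R (map shift g ++ [ eₘₐₓ ]) []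
    +last⋢[] []      ()
    +last⋢[] (_ ∷ _) ()
  walk 5≤k {e = e} {u} {v} uv pre (y ∷ post) uniq free insert (φ , φ-inj , late)
    with role {pre = pre ++ [ y ]} {post} uv (subst (¬_ ∘ ((e₀ ∷ +last) ↪_)) (sym reassoc) free)
           (insert (pre ++ [ y ]) post reassoc)
    where
    reassoc : (pre ++ [ y ]) ++ post ≡ pre ++ y ∷ post
    reassoc = ++-assoc pre [ y ] post
  ... | inj₁ late′ = subst (λ es → Crossing es u v) (++-assoc pre [ y ] post)
    (walk 5≤k uv (pre ++ [ y ]) post (subst Unique (sym (++-assoc pre [ y ] post)) uniq)
      (subst (¬_ ∘ ((e₀ ∷ +last) ↪_)) (sym (++-assoc pre [ y ] post)) free)
      (λ pre′ post′ eq → insert pre′ post′ (trans eq (++-assoc pre [ y ] post)))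
      late′)
  ... | inj₂ (inj₁ (ψ , ψ-inj , early)) =
    contradiction early (late⇒¬early 5≤k uniq free φ-inj ψ-inj late)
  ... | inj₂ (inj₂ cr) = subst (λ es → Crossing es u v) (++-assoc pre [ y ] post) cr

  -- At the left end nothing precedes `e`, so it cannot play `eₘₐₓ`; if it plays `e₀` there, `walk`
  -- takes over.
  insertion-crossing : 5 ≤ k → {e : Edge n} {u v : Fin n} → Joins u v e →
                       ∀ es → Unique es → ¬ ((e₀ ∷ +last) ↪ es) →
                       (∀ pre post → pre ++ post ≡ es → (e₀ ∷ +last) ↪ (pre ++ e ∷ post)) →
                       Crossing es u v
  insertion-crossing 5≤k uv es uniq free insert
    with role {pre = []} {es} uv free (insert [] es refl)
  ... | inj₁ late               = walk 5≤k uv [] es uniq free insert late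
  ... | inj₂ (inj₁ (_ , _ , ()))
  ... | inj₂ (inj₂ cr)          = cr

-- Crossings in saturated graphs and the lower bound.

saturated⇒crossing : 5 ≤ k → (O : CrossingOrder k) (H : EdgeOrderedGraph n) →
  let open CrossingOrder O in
  Saturated H (e₀+ graph order distinct +eₘₐₓ) →
  ∀ {u v} → u ≢ v → ¬ Adjacent (edges H) u v → Crossing (edges H) u v
saturated⇒crossing 5≤k O H (free , sat) {u} {v} u≢v ¬adj with e , uv ← joining u v u≢v =
  insertion-crossing O 5≤k uv (edges H) (unique H) free insert
  where
  insert : ∀ pre post → pre ++ post ≡ edges H → (e₀ ∷ +last O) ↪ (pre ++ e ∷ post)
  insert pre post refl with i , eq ← insertAt-++ pre {post} e
    with φ , φ-inj , s ← sat e (λ e∈ → ¬adj (Any.map (λ { refl → uv }) e∈)) i =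
    φ , (λ {_} {_} → φ-inj) , subst (Sublist (Maps φ) _) eq s

theorem55 : ∀ (k : ℕ) → 5 ≤ k →
  Σ[ G ∈ EdgeOrderedGraph k ]
    Complete G × (λ n → satₑ n (e₀+ G +eₘₐₓ)) ∈Ω[n√log-n]
theorem55 k 5≤k with j , refl ← m≤n⇒∃[o]m+o≡n (<⇒≤ 5≤k) =
  G , G-complete , 8 , 2 , bound
  where
  open CrossingOrder (crossingOrder j)
  G : EdgeOrderedGraph (4 + j)
  G = graph order distinct
  G-complete : Complete G
  G-complete e = Any.map (Joins-injective {e = e} (inj₁ (refl , refl))) (complete (src≢tgt e))
  bound : ∀ n → 2 ≤ n → n ^ 2 * ⌈log₂ n ⌉ ≤ (8 * satₑ n (e₀+ G +eₘₐₓ)) ^ 2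
  bound n 2≤n with H , sat , eq ← IsSatₑ.attained (satₑ-isSatₑ n (e₀+ G +eₘₐₓ)) =
    subst (λ s → n ^ 2 * ⌈log₂ n ⌉ ≤ (8 * s) ^ 2) eq
      (crossing⇒n√log-n 2≤n (unique H) (saturated⇒crossing 5≤k (crossingOrder j) H sat))
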